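{- Let $n,x$ be integers with $1<x<n$, so that $G=C_{2n}(x,1,n)$ is a $5$-regular circulant graph. If $n\equiv x\equiv 2 \pmod 3$, then $G$ is word-representable.
   Context: Two distinct letters $x,y$ alternate in a word $w$ if, after deleting all other letters from $w$, the resulting word is of the form $xyxy\cdots$ or $yxyx\cdots$ (of even or odd length). A graph $G=(V,E)$ is word-representable if there is a word $w$ over the alphabet $V$, containing every letter of $V$ at least once, such that for all distinct $x,y\in V$, $xy\in E$ if and only if $x$ and $y$ alternate in $w$. For an integer $m$ and a set $R$ of positive integers each at most $m/2$, the circulant graph $C_m(R)$ has vertex set $\{0,1,\dots,m-1\}$, with $i$ and $j$ adjacent iff $\min(|i-j|,\,m-|i-j|)\in R$. $C_{2n}(x,1,n)$ denotes the circulant graph on $2n$ vertices with jump set $\{1,x,n\}$; it is $5$-regular exactly when $1<x<n$. -}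

module Defs where

open import Data.Fin using (Fin; toℕ; _≟_)
open import Data.List using (List; []; _∷_; filter)
open import Data.List.Membership.Propositional using (_∈_)
open import Data.List.Relation.Unary.All using (All; []; _∷_; lookup)
open import Data.Nat using (ℕ; zero; suc; _*_; _∸_; _⊓_; _≤_; _<_; ∣_-_∣; s≤s; z≤n)
open import Data.Nat.Properties using (∣-∣-comm; ∣n-n∣≡0; <⇒≤; <-trans; *-monoʳ-≤; ≤-refl; <-irrefl)
open import Data.Product using (_×_; _,_; ∃-syntax; proj₁)
open import Data.Sum using (_⊎_)
open import Function using (_⇔_)
open import Relation.Binary.PropositionalEquality using (_≡_; _≢_; refl; sym; cong; subst)
open import Relation.Nullary using (¬_)
open import Relation.Unary.Properties using (_∪?_)

-- Finite simple graphs on the vertex set {0, …, m − 1}.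
record Graph (m : ℕ) : Set₁ where
  field
    Adj        : Fin m → Fin m → Set
    adj-sym    : ∀ {i j} → Adj i j → Adj j i
    adj-irrefl : ∀ {i} → ¬ Adj i i

Word : ℕ → Set
Word m = List (Fin m)

restrict : ∀ {m} → Fin m → Fin m → Word m → Word m
restrict x y = filter ((_≟ x) ∪? (_≟ y))

-- The word x y x y … of length k.
alternating : ∀ {m} → Fin m → Fin m → ℕ → Word m
alternating x y zero    = []
alternating x y (suc k) = x ∷ alternating y x k

-- Meaningful for x ≢ y only.
Alternate : ∀ {m} → Fin m → Fin m → Word m → Set
Alternate x y w =
  ∃[ k ] (restrict x y w ≡ alternating x y k ⊎ restrict x y w ≡ alternating y x k)

Represents : ∀ {m} → Word m → Graph m → Set
Represents w G =
  (∀ v → v ∈ w) × (∀ x y → x ≢ y → Graph.Adj G x y ⇔ Alternate x y w)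

WordRepresentable : ∀ {m} → Graph m → Set
WordRepresentable G = ∃[ w ] Represents w G

circularDistance : ∀ {m} → Fin m → Fin m → ℕ
circularDistance {m} i j = ∣ toℕ i - toℕ j ∣ ⊓ (m ∸ ∣ toℕ i - toℕ j ∣)

-- 2 * r ≤ m says r ≤ m/2 for the exact (not rounded) quotient.
IsJump : ℕ → ℕ → Set
IsJump m r = 0 < r × 2 * r ≤ m

-- The list R is read as the set of its members.
circulant : (m : ℕ) (R : List ℕ) → All (IsJump m) R → Graph m
circulant m R jumps = record
  { Adj        = λ i j → circularDistance i j ∈ R
  ; adj-sym    = λ {i} {j} → subst (λ d → d ⊓ (m ∸ d) ∈ R) (∣-∣-comm (toℕ i) (toℕ j))
  ; adj-irrefl = λ {i} d∈R →
      <-irrefl (sym (cong (λ d → d ⊓ (m ∸ d)) (∣n-n∣≡0 (toℕ i)))) (proj₁ (lookup jumps d∈R))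
  }

-- C₂ₙ(x, 1, n)
C₂ₙ : (n x : ℕ) → 1 < x → x < n → Graph (2 * n)
C₂ₙ n x 1<x x<n = circulant (2 * n) (x ∷ 1 ∷ n ∷ [])
  ( (0<x , *-monoʳ-≤ 2 (<⇒≤ x<n))
  ∷ (s≤s z≤n , *-monoʳ-≤ 2 0<n)
  ∷ (0<n , ≤-refl)
  ∷ [])
  where
  0<x : 0 < x
  0<x = <⇒≤ 1<x
  0<n : 0 < n
  0<n = <-trans 0<x x<n

{-# OPTIONS --safe #-}

-- Since 2n ≡ 1 and 1, x, n, 2n − x ≢ 0 (mod 3), residues mod 3 properly colour
-- the graph except for the single edge {0, 2n − 1}.  Orient the edges from
-- residue 1 to residue 0 to residue 2, and that edge as 0 → 2n − 1.  A shortcut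
-- needs a directed path with three edges; it could only be 1 → 0 → 2n−1 → 2n−2,
-- but 1 and 2n − 2 are not adjacent.  So the orientation is semi-transitive.
--
-- For a semi-transitive orientation, every edge u → v reads uvuv… in a
-- concatenation of blocks, and for each non-adjacent pair p, q some block
-- repeats a letter.  If q is reachable from p, with D the descendants of q
-- and U the ancestors of p, the block is (V∖D) U D (V∖U), every part listed in a
-- topological order: it contains p p q q, and an edge u → v could fail to read
-- uvuv only for u ∈ U and v ∈ D, where it would be a shortcut.  If neither is
-- reachable from the other, two topological orders listing p and q in opposite
-- ways give p q q p.
module Submission where

open import Defs
open import Data.Bool using (true; false; if_then_else_)
open import Data.Empty using (⊥)
open import Data.Fin using (Fin; toℕ; _≟_)
open import Data.Fin.Properties using (any?; toℕ-injective; toℕ<n)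
open import Data.List using (List; []; _∷_; _++_; filter; allFin; cartesianProduct)
open import Data.List.Membership.DecPropositional using () renaming (_∈?_ to member?)
open import Data.List.Membership.Propositional using (_∈_)
open import Data.List.Membership.Propositional.Properties
  using (∈-allFin; ∈-filter⁺; ∈-++⁺ˡ; ∈-cartesianProduct⁺)
open import Data.List.Properties using (filter-++; filter-≐; ++-assoc)
open import Data.List.Relation.Binary.Permutation.Propositional using (↭-sym; ↭⇒↭ₛ)
open import Data.List.Relation.Binary.Permutation.Propositional.Properties using (∈-resp-↭)
import Data.List.Relation.Binary.Permutation.Setoid.Properties as Permutation
open import Data.List.Relation.Unary.All as All using (All; []; _∷_)
open import Data.List.Relation.Unary.All.Properties using (all-filter)
open import Data.List.Relation.Unary.AllPairs using (AllPairs; []; _∷_)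
import Data.List.Relation.Unary.AllPairs.Properties as AllPairs
open import Data.List.Relation.Unary.Any using (here; there)
open import Data.List.Relation.Unary.Linked as Linked using (Linked; []; [-]; _∷_)
open import Data.List.Relation.Unary.Linked.Properties using (Linked⇒AllPairs)
open import Data.List.Relation.Unary.Unique.Propositional using (Unique)
open import Data.List.Relation.Unary.Unique.Propositional.Properties using (allFin⁺)
import Data.List.Sort as Sort
open import Data.Nat using (ℕ; zero; suc; _+_; _*_; _∸_; _⊓_; _≤_; _<_; _<?_; _%_; z≤n; s≤s)
  renaming (_≟_ to _≟ℕ_)
open import Data.Nat.DivMod using (%-distribˡ-+; m%n<n)
open import Data.Nat.Properties hiding (_≟_)
open import Data.Product using (_×_; _,_; ∃; ∃-syntax; proj₁; proj₂)
open import Data.Sum as Sum using (_⊎_; inj₁; inj₂; [_,_]; swap)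
open import Function using (mk⇔; _∘_)
open import Relation.Binary using (tri<; tri≈; tri>)
open import Relation.Binary.Construct.Closure.ReflexiveTransitive using (Star; ε; _◅_; _◅◅_)
import Relation.Binary.Construct.On as On
open import Relation.Binary.PropositionalEquality
  using (_≡_; _≢_; refl; sym; trans; cong; cong₂; subst; setoid; module ≡-Reasoning)
open import Relation.Nullary using (¬_; Dec; yes; no; contradiction; _×-dec_)
open import Relation.Nullary.Decidable using (map′; does)
open import Relation.Unary using (Decidable)
open import Relation.Unary.Properties using (_∪?_; ∁?)

-- Filtering lists, and words in two letters.

filter-comm : ∀ {A : Set} {P Q : A → Set} (P? : Decidable P) (Q? : Decidable Q) xs →
  filter P? (filter Q? xs) ≡ filter Q? (filter P? xs)
filter-comm P? Q? []       = refl
filter-comm P? Q? (x ∷ xs) with P? x in p | Q? x in q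
... | yes _ | yes _ rewrite p | q = cong (x ∷_) (filter-comm P? Q? xs)
... | yes _ | no _  rewrite q     = filter-comm P? Q? xs
... | no _  | yes _ rewrite p     = filter-comm P? Q? xs
... | no _  | no _                = filter-comm P? Q? xs

-- Unlike filter P? (u ∷ v ∷ []), this exposes both decisions to a simultaneous with.
filter₂ : ∀ {A : Set} {P : A → Set} → Decidable P → A → A → List A
filter₂ P? u v = (if does (P? u) then u ∷ [] else []) ++ (if does (P? v) then v ∷ [] else [])

filter-pair : ∀ {A : Set} {P : A → Set} (P? : Decidable P) u v →
  filter P? (u ∷ v ∷ []) ≡ filter₂ P? u v
filter-pair P? u v with does (P? u)
filter-pair P? u v | true with does (P? v)
... | true  = refl
... | false = refl
filter-pair P? u v | false with does (P? v)
... | true  = refl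
... | false = refl

unique-pair : ∀ {A : Set} {u v : A} {ys} → u ≢ v → Unique ys →
  All (λ z → z ≡ u ⊎ z ≡ v) ys → u ∈ ys → v ∈ ys →
  ys ≡ u ∷ v ∷ [] ⊎ ys ≡ v ∷ u ∷ []
unique-pair u≢v ([] ∷ []) _ (here refl) (here refl) = contradiction refl u≢v
unique-pair u≢v ((a≢b ∷ []) ∷ _) (inj₁ refl ∷ inj₁ refl ∷ _) _ _ = contradiction refl a≢b
unique-pair u≢v ((a≢b ∷ []) ∷ _) (inj₁ refl ∷ inj₂ refl ∷ _) _ _ = inj₁ refl
unique-pair u≢v ((a≢b ∷ []) ∷ _) (inj₂ refl ∷ inj₁ refl ∷ _) _ _ = inj₂ refl
unique-pair u≢v ((a≢b ∷ []) ∷ _) (inj₂ refl ∷ inj₂ refl ∷ _) _ _ = contradiction refl a≢b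
unique-pair u≢v ((a≢b ∷ a≢c ∷ _) ∷ (b≢c ∷ _) ∷ _) (a ∷ b ∷ c ∷ _) _ _
  with a | b | c
... | inj₁ refl | inj₁ refl | _         = contradiction refl a≢b
... | inj₂ refl | inj₂ refl | _         = contradiction refl a≢b
... | inj₁ refl | inj₂ refl | inj₁ refl = contradiction refl a≢c
... | inj₁ refl | inj₂ refl | inj₂ refl = contradiction refl b≢c
... | inj₂ refl | inj₁ refl | inj₁ refl = contradiction refl b≢c
... | inj₂ refl | inj₁ refl | inj₂ refl = contradiction refl a≢c

¬Linked-repeat : ∀ {A : Set} xs {z : A} {ys} → ¬ Linked _≢_ (xs ++ z ∷ z ∷ ys)
¬Linked-repeat []       (z≢z ∷ _) = z≢z refl
¬Linked-repeat (x ∷ xs) link      = ¬Linked-repeat xs (Linked.tail link)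

-- Restrictions of words, alternation and its obstruction.

module _ {m : ℕ} where

  restrict-++ : ∀ (u v : Fin m) xs ys →
    restrict u v (xs ++ ys) ≡ restrict u v xs ++ restrict u v ys
  restrict-++ u v = filter-++ ((_≟ u) ∪? (_≟ v))

  restrict-swap : ∀ (u v : Fin m) w → restrict u v w ≡ restrict v u w
  restrict-swap u v = filter-≐ ((_≟ u) ∪? (_≟ v)) ((_≟ v) ∪? (_≟ u)) (swap , swap)

  restrict-++₄ : ∀ (u v : Fin m) as bs cs ds {as′ bs′ cs′ ds′} →
    restrict u v as ≡ as′ → restrict u v bs ≡ bs′ →
    restrict u v cs ≡ cs′ → restrict u v ds ≡ ds′ →
    restrict u v (as ++ bs ++ cs ++ ds) ≡ as′ ++ bs′ ++ cs′ ++ ds′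
  restrict-++₄ u v as bs cs ds refl refl refl refl = begin
    restrict u v (as ++ bs ++ cs ++ ds)
      ≡⟨ restrict-++ u v as _ ⟩
    restrict u v as ++ restrict u v (bs ++ cs ++ ds)
      ≡⟨ cong (restrict u v as ++_) (restrict-++ u v bs _) ⟩
    restrict u v as ++ restrict u v bs ++ restrict u v (cs ++ ds)
      ≡⟨ cong (λ zs → restrict u v as ++ restrict u v bs ++ zs) (restrict-++ u v cs ds) ⟩
    restrict u v as ++ restrict u v bs ++ restrict u v cs ++ restrict u v ds ∎
    where open ≡-Reasoning

  -- Only even lengths join up: after an odd length the seam would read `u u`.
  alternating-++ : ∀ (u v : Fin m) k l →
    alternating u v (k * 2) ++ alternating u v (l * 2) ≡ alternating u v ((k + l) * 2)
  alternating-++ u v zero    l = refl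
  alternating-++ u v (suc k) l = cong (λ zs → u ∷ v ∷ zs) (alternating-++ u v k l)

  alternating-Linked : ∀ {u v : Fin m} → u ≢ v → ∀ k → Linked _≢_ (alternating u v k)
  alternating-Linked u≢v zero          = []
  alternating-Linked u≢v (suc zero)    = [-]
  alternating-Linked u≢v (suc (suc k)) = u≢v ∷ alternating-Linked (u≢v ∘ sym) (suc k)

  -- Two equal neighbours in the restriction obstruct alternation and survive any extension of the
  -- word on either side. Hence one block per non-adjacent pair is enough.
  Repeats : Fin m → Fin m → Word m → Set
  Repeats p q w = ∃[ xs ] ∃[ z ] ∃[ ys ] restrict p q w ≡ xs ++ z ∷ z ∷ ys

  Repeats-swap : ∀ {p q w} → Repeats p q w → Repeats q p w
  Repeats-swap {p} {q} {w} (xs , z , ys , eq) = xs , z , ys , trans (restrict-swap q p w) eq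

  Repeats-++ˡ : ∀ {p q w} w′ → Repeats p q w → Repeats p q (w ++ w′)
  Repeats-++ˡ {p} {q} {w} w′ (xs , z , ys , eq) = xs , z , ys ++ restrict p q w′ ,
    trans (restrict-++ p q w w′) (trans (cong (_++ restrict p q w′) eq) (++-assoc xs (z ∷ z ∷ ys) _))

  Repeats-++ʳ : ∀ {p q w} w′ → Repeats p q w → Repeats p q (w′ ++ w)
  Repeats-++ʳ {p} {q} {w} w′ (xs , z , ys , eq) = restrict p q w′ ++ xs , z , ys ,
    trans (restrict-++ p q w′ w)
      (trans (cong (restrict p q w′ ++_) eq) (sym (++-assoc (restrict p q w′) xs _)))

  Repeats⇒¬Alternate : ∀ {p q w} → p ≢ q → Repeats p q w → ¬ Alternate p q w
  Repeats⇒¬Alternate p≢q (xs , z , ys , eq) (k , alt) = ¬Linked-repeat xs (subst (Linked _≢_) eq linked)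
    where
    linked = [ (λ e → subst (Linked _≢_) (sym e) (alternating-Linked p≢q k))
             , (λ e → subst (Linked _≢_) (sym e) (alternating-Linked (p≢q ∘ sym) k)) ] alt

-- Digraphs graded by levels: reachability and topological order.

module Reachability {m : ℕ} {E : Fin m → Fin m → Set} (E? : ∀ u v → Dec (E u v))
  (level : Fin m → ℕ) (E⇒< : ∀ {u v} → E u v → level u < level v) where

  infix 4 _↝_ _↝?_
  _↝_ : Fin m → Fin m → Set
  _↝_ = Star E

  ↝⇒≤ : ∀ {u v} → u ↝ v → level u ≤ level v
  ↝⇒≤ ε       = ≤-refl
  ↝⇒≤ (e ◅ p) = ≤-trans (<⇒≤ (E⇒< e)) (↝⇒≤ p)

  ↝∧≥⇒≡ : ∀ {u v} → u ↝ v → level v ≤ level u → u ≡ v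
  ↝∧≥⇒≡ ε       _   = refl
  ↝∧≥⇒≡ (e ◅ p) v≤u = contradiction (≤-trans (E⇒< e) (↝⇒≤ p)) (≤⇒≯ v≤u)

  ↝-antisym : ∀ {u v} → u ↝ v → v ↝ u → u ≡ v
  ↝-antisym p q = ↝∧≥⇒≡ p (↝⇒≤ q)

  -- The bound `k` on the level gap drives the recursion, since every edge climbs at least one
  -- level. At gap 0 only the empty path is left.
  reach? : ∀ k u v → level v ≤ level u + k → Dec (u ↝ v)
  reach? zero u v v≤u = map′ (λ { refl → ε }) (λ p → ↝∧≥⇒≡ p (subst (level v ≤_) (+-identityʳ _) v≤u)) (u ≟ v)
  reach? (suc k) u v v≤u+k with u ≟ v
  ... | yes refl = yes ε
  ... | no u≢v   = map′ (λ { (_ , e , p) → e ◅ p })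
                        (λ { ε → contradiction refl u≢v ; (e ◅ p) → _ , e , p })
                        (any? first-step?)
    where
    first-step? : ∀ w → Dec (E u w × w ↝ v)
    first-step? w with E? u w
    ... | no ¬e = no (¬e ∘ proj₁)
    ... | yes e = map′ (e ,_) proj₂ (reach? k w v
      (≤-trans v≤u+k (subst (_≤ level w + k) (sym (+-suc (level u) k)) (+-monoˡ-≤ k (E⇒< e)))))

  abstract
    _↝?_ : ∀ u v → Dec (u ↝ v)
    -- As `level u` is at least 0, `level v` always bounds the gap.
    u ↝? v = reach? (level v) u v (m≤n+m (level v) (level u))

  open Sort (On.decTotalOrder ≤-decTotalOrder level) using (sort; sort-↭; sort-↗)

  -- Edges climb strictly, so sorting by level is a topological sort. Vertices on one level come in
  -- an unspecified order.
  topological : Word m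
  topological = sort (allFin m)

  ∈-topological : ∀ v → v ∈ topological
  ∈-topological v = ∈-resp-↭ (↭-sym (sort-↭ (allFin m))) (∈-allFin v)

  restrict-topological : ∀ {u v} → u ≢ v →
    restrict u v topological ≡ u ∷ v ∷ [] ⊎ restrict u v topological ≡ v ∷ u ∷ []
  restrict-topological {u} {v} u≢v = unique-pair u≢v
    (AllPairs.filter⁺ pair? (Permutation.Unique-resp-↭ (setoid (Fin m))
      (↭⇒↭ₛ (↭-sym (sort-↭ (allFin m)))) (allFin⁺ m)))
    (all-filter pair? topological)
    (∈-filter⁺ pair? (∈-topological u) (inj₁ refl))
    (∈-filter⁺ pair? (∈-topological v) (inj₂ refl))
    where pair? = (_≟ u) ∪? (_≟ v)

  restrict-topological-< : ∀ {u v} → level u < level v → restrict u v topological ≡ u ∷ v ∷ []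
  restrict-topological-< {u} {v} u<v with restrict-topological {u} {v} (λ { refl → <-irrefl refl u<v })
  ... | inj₁ eq = eq
  ... | inj₂ eq = contradiction (head-≤ (subst (AllPairs _) eq sorted)) (<⇒≱ u<v)
    where
    sorted : AllPairs (λ a b → level a ≤ level b) (restrict u v topological)
    sorted = AllPairs.filter⁺ ((_≟ u) ∪? (_≟ v)) (Linked⇒AllPairs ≤-trans (sort-↗ (allFin m)))
    head-≤ : AllPairs (λ a b → level a ≤ level b) (v ∷ u ∷ []) → level v ≤ level u
    head-≤ ((v≤u ∷ []) ∷ _) = v≤u

-- From a semi-transitive orientation to a representing word.

module SemiTransitive {m : ℕ} {E : Fin m → Fin m → Set} (E? : ∀ u v → Dec (E u v))
  (level : Fin m → ℕ) (E⇒< : ∀ {u v} → E u v → level u < level v)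
  -- Semi-transitivity: `p` and `q` are any two vertices, in this order, on a directed path from `u`
  -- to `v`, the ends included.
  (no-shortcut : ∀ {u p q v} → Star E u p → Star E p q → Star E q v → E u v → p ≢ q → E p q) where

  open Reachability E? level E⇒<

  ordered : {S : Fin m → Set} → Decidable S → Word m
  ordered S? = filter S? topological

  restrict-ordered : ∀ {S : Fin m → Set} (S? : Decidable S) {u v a b} →
    restrict u v topological ≡ a ∷ b ∷ [] →
    restrict u v (ordered S?) ≡ filter₂ S? a b
  restrict-ordered S? {u} {v} {a} {b} r = trans (filter-comm ((_≟ u) ∪? (_≟ v)) S? topological)
    (trans (cong (filter S?) r) (filter-pair S? a b))

  -- The restriction starts at the tail `u` in every block and has even length, so the property
  -- passes to concatenations.
  Uniform : Word m → Set
  Uniform w = ∀ {u v} → E u v → ∃[ k ] restrict u v w ≡ alternating u v (k * 2)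

  Uniform-++ : ∀ {w w′} → Uniform w → Uniform w′ → Uniform (w ++ w′)
  Uniform-++ {w} {w′} f g {u} {v} e with k , eq ← f e | l , eq′ ← g e =
    k + l , trans (restrict-++ u v w w′) (trans (cong₂ _++_ eq eq′) (alternating-++ u v k l))

  topological-uniform : Uniform topological
  topological-uniform e = 1 , restrict-topological-< (E⇒< e)

  -- Equal and adjacent pairs are separated vacuously, so that a separator exists for every pair of
  -- vertices.
  Separates : Word m → Fin m → Fin m → Set
  Separates w p q = p ≢ q → ¬ E p q → ¬ E q p → Repeats p q w

  -- The first and third parts together list every vertex once, and so do the second and fourth;
  -- hence every letter occurs exactly twice.
  ancestors-first : Fin m → Fin m → Word m
  ancestors-first p q =
    ordered (∁? (q ↝?_)) ++ ordered (_↝? p) ++ ordered (q ↝?_) ++ ordered (∁? (_↝? p))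

  restrict-ancestors-first : ∀ p q {u v a b} → restrict u v topological ≡ a ∷ b ∷ [] →
    restrict u v (ancestors-first p q) ≡
      filter₂ (∁? (q ↝?_)) a b ++ filter₂ (_↝? p) a b ++
      filter₂ (q ↝?_) a b ++ filter₂ (∁? (_↝? p)) a b
  restrict-ancestors-first p q {u} {v} r = restrict-++₄ u v
    (ordered (∁? (q ↝?_))) (ordered (_↝? p)) (ordered (q ↝?_)) (ordered (∁? (_↝? p)))
    (restrict-ordered (∁? (q ↝?_)) r) (restrict-ordered (_↝? p) r)
    (restrict-ordered (q ↝?_) r) (restrict-ordered (∁? (_↝? p)) r)

  ancestors-first-uniform : ∀ {p q} → p ↝ q → p ≢ q → ¬ E p q → Uniform (ancestors-first p q)
  ancestors-first-uniform {p} {q} pq p≢q ¬pEq {u} {v} e = 2 ,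
    trans (restrict-ancestors-first p q (restrict-topological-< (E⇒< e))) parts
    where
    parts : filter₂ (∁? (q ↝?_)) u v ++ filter₂ (_↝? p) u v ++
            filter₂ (q ↝?_) u v ++ filter₂ (∁? (_↝? p)) u v ≡ alternating u v 4
    parts with q ↝? u | q ↝? v | u ↝? p | v ↝? p
    -- Descendants of `q` are closed under edges, ancestors of `p` under reversed edges, and
    -- `u ↝ p ↝ q ↝ v` together with the edge from `u` to `v` would force one from `p` to `q`. The
    -- five patterns left all spell `u v u v`.
    ... | yes qu | no ¬qv | _      | _      = contradiction (qu ◅◅ e ◅ ε) ¬qv
    ... | _      | _      | no ¬up | yes vp = contradiction (e ◅ vp) ¬up
    ... | _      | yes qv | yes up | _      = contradiction (no-shortcut up pq qv e p≢q) ¬pEq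
    ... | no _   | no _   | no _   | no _   = refl
    ... | no _   | no _   | yes _  | no _   = refl
    ... | no _   | no _   | yes _  | yes _  = refl
    ... | no _   | yes _  | no _   | no _   = refl
    ... | yes _  | yes _  | no _   | no _   = refl

  ancestors-first-repeats : ∀ {p q} → p ↝ q → p ≢ q → Repeats p q (ancestors-first p q)
  ancestors-first-repeats {p} {q} pq p≢q = [] , p , q ∷ q ∷ [] ,
    trans (restrict-ancestors-first p q (restrict-topological-< (≰⇒> (p≢q ∘ ↝∧≥⇒≡ pq)))) parts
    where
    parts : filter₂ (∁? (q ↝?_)) p q ++ filter₂ (_↝? p) p q ++
            filter₂ (q ↝?_) p q ++ filter₂ (∁? (_↝? p)) p q ≡ p ∷ p ∷ q ∷ q ∷ []
    -- The decision `q ↝? p` settles both whether `p` descends from `q` and whether `q` is an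
    -- ancestor of `p`.
    parts with q ↝? p | q ↝? q | p ↝? p
    ... | yes qp | _      | _      = contradiction (↝-antisym pq qp) p≢q
    ... | _      | no ¬qq | _      = contradiction ε ¬qq
    ... | _      | _      | no ¬pp = contradiction ε ¬pp
    ... | no _   | yes _  | yes _  = refl

  -- Descendants of `p` are closed under edges, so moving them to the end gives another topological
  -- order. It puts `p` behind everything that `p` does not reach.
  descendants-last : Fin m → Word m
  descendants-last p = ordered (∁? (p ↝?_)) ++ ordered (p ↝?_)

  restrict-descendants-last : ∀ p {u v a b} → restrict u v topological ≡ a ∷ b ∷ [] →
    restrict u v (descendants-last p) ≡
      filter₂ (∁? (p ↝?_)) a b ++ filter₂ (p ↝?_) a b
  restrict-descendants-last p {u} {v} r =
    trans (restrict-++ u v (ordered (∁? (p ↝?_))) (ordered (p ↝?_)))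
      (cong₂ _++_ (restrict-ordered (∁? (p ↝?_)) r) (restrict-ordered (p ↝?_) r))

  descendants-last-uniform : ∀ p → Uniform (descendants-last p)
  descendants-last-uniform p {u} {v} e =
    1 , trans (restrict-descendants-last p (restrict-topological-< (E⇒< e))) parts
    where
    parts : filter₂ (∁? (p ↝?_)) u v ++ filter₂ (p ↝?_) u v ≡ u ∷ v ∷ []
    parts with p ↝? u | p ↝? v
    ... | yes pu | no ¬pv = contradiction (pu ◅◅ e ◅ ε) ¬pv
    ... | no _   | no _   = refl
    ... | no _   | yes _  = refl
    ... | yes _  | yes _  = refl

  -- `q` falls into the first part and `p` into the second, whichever way `topological` lists them.
  restrict-descendants-last-incomparable : ∀ {p q} → ¬ p ↝ q →
    restrict p q (descendants-last p) ≡ q ∷ p ∷ []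
  restrict-descendants-last-incomparable {p} {q} ¬pq
    with restrict-topological {p} {q} (λ { refl → ¬pq ε })
  ... | inj₁ r = trans (restrict-descendants-last p r) parts
    where
    parts : filter₂ (∁? (p ↝?_)) p q ++ filter₂ (p ↝?_) p q ≡ q ∷ p ∷ []
    parts with p ↝? p | p ↝? q
    ... | no ¬pp | _      = contradiction ε ¬pp
    ... | _      | yes pq = contradiction pq ¬pq
    ... | yes _  | no _   = refl
  ... | inj₂ r = trans (restrict-descendants-last p r) parts
    where
    parts : filter₂ (∁? (p ↝?_)) q p ++ filter₂ (p ↝?_) q p ≡ q ∷ p ∷ []
    parts with p ↝? p | p ↝? q
    ... | no ¬pp | _      = contradiction ε ¬pp
    ... | _      | yes pq = contradiction pq ¬pq
    ... | yes _  | no _   = refl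

  incomparable-repeats : ∀ {p q} → ¬ p ↝ q → ¬ q ↝ p →
    Repeats p q (descendants-last q ++ descendants-last p)
  -- The first order reads `p q` and the second `q p`; the repeated `q` sits at the seam.
  incomparable-repeats {p} {q} ¬pq ¬qp = p ∷ [] , q , p ∷ [] ,
    trans (restrict-++ p q (descendants-last q) (descendants-last p))
      (cong₂ _++_
        (trans (restrict-swap p q (descendants-last q)) (restrict-descendants-last-incomparable ¬qp))
        (restrict-descendants-last-incomparable ¬pq))

  comparable-separator : ∀ {p q} → p ↝ q → ∃[ w ] (Uniform w × Separates w p q)
  comparable-separator {p} {q} pq with p ≟ q | E? p q
  -- Equal or adjacent vertices need no separation, and any uniform word serves.
  ... | yes refl | _      = topological , topological-uniform , λ p≢p → contradiction refl p≢p
  ... | no _     | yes e  = topological , topological-uniform , λ _ ¬e → contradiction e ¬e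
  ... | no p≢q   | no ¬e  = ancestors-first p q , ancestors-first-uniform pq p≢q ¬e ,
    λ _ _ _ → ancestors-first-repeats pq p≢q

  separator : ∀ p q → ∃[ w ] (Uniform w × Separates w p q)
  separator p q with p ↝? q | q ↝? p
  ... | yes pq | _      = comparable-separator pq
  ... | no _   | yes qp with w , uniform , separates ← comparable-separator qp =
    w , uniform , λ p≢q ¬pEq ¬qEp → Repeats-swap {w = w} (separates (p≢q ∘ sym) ¬qEp ¬pEq)
  ... | no ¬pq | no ¬qp = descendants-last q ++ descendants-last p ,
    Uniform-++ {descendants-last q} {descendants-last p}
      (descendants-last-uniform q) (descendants-last-uniform p) ,
    λ _ _ _ → incomparable-repeats ¬pq ¬qp

  separate-all : (ps : List (Fin m × Fin m)) →
    ∃[ w ] (Uniform w × All (λ (p , q) → Separates w p q) ps)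
  separate-all [] = topological , topological-uniform , []
  separate-all ((p , q) ∷ ps)
    with w , uniform , sep ← separator p q | w′ , uniform′ , seps ← separate-all ps =
    w ++ w′ , Uniform-++ {w} {w′} uniform uniform′ ,
    (λ p≢q ¬e ¬e′ → Repeats-++ˡ {w = w} w′ (sep p≢q ¬e ¬e′)) ∷
    All.map (λ s p≢q ¬e ¬e′ → Repeats-++ʳ {w = w′} w (s p≢q ¬e ¬e′)) seps

  uniform⇒alternate : ∀ {w u v} → Uniform w → E u v → Alternate u v w
  uniform⇒alternate uniform e with k , eq ← uniform e = k * 2 , inj₁ eq

  Alternate-swap : ∀ {w} {u v : Fin m} → Alternate u v w → Alternate v u w
  Alternate-swap {w} {u} {v} (k , alt) =
    k , swap (Sum.map (trans (restrict-swap v u w)) (trans (restrict-swap v u w)) alt)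

  wordRepresentable : (G : Graph m) →
    (∀ {u v} → Graph.Adj G u v → E u v ⊎ E v u) →
    (∀ {u v} → E u v → Graph.Adj G u v) → WordRepresentable G
  wordRepresentable G orient E⇒Adj
    with w , uniform , seps ← separate-all (cartesianProduct (allFin m) (allFin m)) =
    -- The prefix makes every letter occur and, being uniform itself, preserves the alternation
    -- along edges.
    topological ++ w , (λ v → ∈-++⁺ˡ (∈-topological v)) , λ u v u≢v → mk⇔
      ([ uniform⇒alternate {topological ++ w} uniform⁺
       , Alternate-swap {topological ++ w} ∘ uniform⇒alternate {topological ++ w} uniform⁺ ] ∘ orient)
      (adjacent u v u≢v)
    where
    uniform⁺ : Uniform (topological ++ w)
    uniform⁺ = Uniform-++ {topological} {w} topological-uniform uniform
    adjacent : ∀ u v → u ≢ v → Alternate u v (topological ++ w) → Graph.Adj G u v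
    adjacent u v u≢v alt with E? u v | E? v u
    ... | yes e | _      = E⇒Adj e
    ... | no _  | yes e  = Graph.adj-sym G (E⇒Adj e)
    ... | no ¬e | no ¬e′ = contradiction alt (Repeats⇒¬Alternate {w = topological ++ w} u≢v
      (Repeats-++ʳ {w = w} topological
        (All.lookup seps (∈-cartesianProduct⁺ (∈-allFin u) (∈-allFin v)) u≢v ¬e ¬e′)))

-- Arithmetic modulo 3.

+-residue : ∀ {r s} a b → a % 3 ≡ r → b % 3 ≡ s → (a + b) % 3 ≡ (r + s) % 3
+-residue a b refl refl = %-distribˡ-+ a b 3

shift₂-residue : ∀ r → r < 3 → (r + 2) % 3 ≢ r
shift₂-residue 0 _ ()
shift₂-residue 1 _ ()
shift₂-residue 2 _ ()
shift₂-residue (suc (suc (suc _))) (s≤s (s≤s (s≤s ())))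

shift₁-residue : ∀ r → r < 3 → (1 + r) % 3 ≢ r
shift₁-residue 0 _ ()
shift₁-residue 1 _ ()
shift₁-residue 2 _ ()
shift₁-residue (suc (suc (suc _))) (s≤s (s≤s (s≤s ())))

-- Since 2 + 2 is 1 modulo 3, the residue 2 is its own complement in a sum of residue 1. So going
-- round the cycle the other way turns a jump of residue 2 into one of residue 2.
complement-residue : ∀ a b → b % 3 ≡ 2 → (a + b) % 3 ≡ 1 → a % 3 ≡ 2
complement-residue a b b≡2 sum≡1 = go (a % 3) (m%n<n a 3) (trans (sym (+-residue a b refl b≡2)) sum≡1)
  where
  go : ∀ r → r < 3 → (r + 2) % 3 ≡ 1 → r ≡ 2
  go 0 _ ()
  go 1 _ ()
  go 2 _ _ = refl
  go (suc (suc (suc _))) (s≤s (s≤s (s≤s ()))) _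

four-levels : ∀ {a b c d} → a < b → b < c → c < d → d ≤ 3 → a ≡ 0 × b ≡ 1 × c ≡ 2 × d ≡ 3
four-levels {a} a<b b<c c<d d≤3 =
  n≤0⇒n≡0 a≤0 , ≤-antisym b≤1 1≤b , ≤-antisym c≤2 2≤c , ≤-antisym d≤3 (≤-trans (s≤s 2≤c) c<d)
  where
  c≤2 = ≤-pred (≤-trans c<d d≤3)
  b≤1 = ≤-pred (≤-trans b<c c≤2)
  a≤0 = ≤-pred (≤-trans a<b b≤1)
  1≤b = ≤-trans (s≤s z≤n) a<b
  2≤c = ≤-trans (s≤s 1≤b) b<c

-- Edges and levels of the circulant graph.

module _ (n x : ℕ) (1<x : 1 < x) (x<n : x < n) (n≡2 : n % 3 ≡ 2) (x≡2 : x % 3 ≡ 2) where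

  private
    N = 2 * n
    G = C₂ₙ n x 1<x x<n
  open Graph G using (Adj; adj-sym; adj-irrefl)

  N≡n+n : N ≡ n + n
  N≡n+n = cong (n +_) (+-identityʳ n)

  N-residue : N % 3 ≡ 1
  N-residue = trans (cong (_% 3) N≡n+n) (+-residue n n n≡2 n≡2)

  -- Describes adjacent `i < j`. Jumps of `x` or `n`, either way round the cycle, all add 2 modulo
  -- 3, and only this is kept of them. A jump of 1 is kept exactly: it joins successive vertices or
  -- 0 and `N - 1`.
  data Step (i j : ℕ) : Set where
    shift₂ : j % 3 ≡ (i % 3 + 2) % 3 → Step i j
    next   : suc i ≡ j → Step i j
    wrap   : i ≡ 0 → suc j ≡ N → Step i j

  distance⇒step : ∀ {i j d} → i + d ≡ j → j < N → d ⊓ (N ∸ d) ∈ x ∷ 1 ∷ n ∷ [] → Step i j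
  distance⇒step {i} {j} {d} refl j<N jump with ⊓-sel d (N ∸ d)
  ... | inj₁ eq = direct (subst (_∈ x ∷ 1 ∷ n ∷ []) eq jump)
    where
    direct : d ∈ x ∷ 1 ∷ n ∷ [] → Step i j
    direct (here refl)                 = shift₂ (+-residue i d refl x≡2)
    direct (there (here refl))         = next (+-comm 1 i)
    direct (there (there (here refl))) = shift₂ (+-residue i d refl n≡2)
  ... | inj₂ eq = around (N ∸ d) (m+[n∸m]≡n d≤N) (subst (_∈ x ∷ 1 ∷ n ∷ []) eq jump)
    where
    d≤N : d ≤ N
    d≤N = ≤-trans (m≤n+m d i) (<⇒≤ j<N)
    around : ∀ e → d + e ≡ N → e ∈ x ∷ 1 ∷ n ∷ [] → Step i j
    around e sum (here refl) =
      shift₂ (+-residue i d refl (complement-residue d e x≡2 (trans (cong (_% 3) sum) N-residue)))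
    around e sum (there (there (here refl))) =
      shift₂ (+-residue i d refl (complement-residue d e n≡2 (trans (cong (_% 3) sum) N-residue)))
    around e sum (there (here refl)) = wrap i≡0 (trans (cong (λ k → suc (k + d)) i≡0) 1+d≡N)
      where
      1+d≡N : suc d ≡ N
      1+d≡N = trans (+-comm 1 d) sum
      i≡0 : i ≡ 0
      -- Here `d = N - 1`, so `i + d < N` leaves only `i = 0`.
      i≡0 = n≤0⇒n≡0 (+-cancelʳ-≤ d i 0 (≤-pred (subst (i + d <_) (sym 1+d≡N) j<N)))

  adj⇒step : ∀ {i j} → Adj i j → toℕ i < toℕ j → Step (toℕ i) (toℕ j)
  adj⇒step {i} {j} adj i<j = distance⇒step (m+[n∸m]≡n (<⇒≤ i<j)) (toℕ<n j)
    (subst (λ d → d ⊓ (N ∸ d) ∈ x ∷ 1 ∷ n ∷ []) (m≤n⇒∣m-n∣≡n∸m (<⇒≤ i<j)) adj)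

  -- Adding 1 or 2 modulo 3 fixes no residue, so only the wrapping edge can join equal ones.
  step-residue : ∀ {i j} → Step i j → i % 3 ≡ j % 3 → i ≡ 0 × suc j ≡ N
  step-residue {i} (shift₂ j≡) i≡j = contradiction (sym (trans i≡j j≡)) (shift₂-residue (i % 3) (m%n<n i 3))
  step-residue {i} (next refl) i≡j =
    contradiction (sym (trans i≡j (+-residue 1 i refl refl))) (shift₁-residue (i % 3) (m%n<n i 3))
  step-residue (wrap i≡0 j≡N) _ = i≡0 , j≡N

  adj-residue : ∀ {i j} → Adj i j → toℕ i % 3 ≡ toℕ j % 3 →
    (toℕ i ≡ 0 × suc (toℕ j) ≡ N) ⊎ (toℕ j ≡ 0 × suc (toℕ i) ≡ N)
  adj-residue {i} {j} adj i≡j with <-cmp (toℕ i) (toℕ j)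
  ... | tri< i<j _ _ = inj₁ (step-residue (adj⇒step adj i<j) i≡j)
  ... | tri> _ _ j<i = inj₂ (step-residue (adj⇒step (adj-sym {i} {j} adj) j<i) (sym i≡j))
  ... | tri≈ _ eq _ with refl ← toℕ-injective {i = i} {j} eq = contradiction adj (adj-irrefl {i})

  -- Residues are ranked 1, 0, 2. The vertex `N - 1`, of residue 0, gets a level of its own just
  -- above the other vertices of residue 0, so that its edge to 0 also climbs.
  data Level (i : ℕ) : ℕ → Set where
    residue₁ : i % 3 ≡ 1 → Level i 0
    residue₀ : i % 3 ≡ 0 → suc i ≢ N → Level i 1
    last     : i % 3 ≡ 0 → suc i ≡ N → Level i 2
    residue₂ : i % 3 ≡ 2 → Level i 3

  ∃-level : ∀ i → ∃ (Level i)
  ∃-level i = go (i % 3) refl (m%n<n i 3)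
    where
    go : ∀ r → i % 3 ≡ r → r < 3 → ∃ (Level i)
    go 0 i≡0 _ with suc i ≟ℕ N
    ... | yes eq = 2 , last i≡0 eq
    ... | no neq = 1 , residue₀ i≡0 neq
    go 1 i≡1 _ = 0 , residue₁ i≡1
    go 2 i≡2 _ = 3 , residue₂ i≡2
    go (suc (suc (suc _))) _ (s≤s (s≤s (s≤s ())))

  level : Fin N → ℕ
  level i = proj₁ (∃-level (toℕ i))

  at-level : ∀ i → Level (toℕ i) (level i)
  at-level i = proj₂ (∃-level (toℕ i))

  Level-≤3 : ∀ {i l} → Level i l → l ≤ 3
  Level-≤3 (residue₁ _)   = z≤n
  Level-≤3 (residue₀ _ _) = s≤s z≤n
  Level-≤3 (last _ _)     = s≤s (s≤s z≤n)
  Level-≤3 (residue₂ _)   = s≤s (s≤s (s≤s z≤n))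

  nonzero-residue : ∀ {i r} → i % 3 ≡ suc r → i ≢ 0
  nonzero-residue () refl

  -- Equal levels mean equal residues, and the one edge between equal residues has its ends on
  -- levels 1 and 2.
  adj⇒level≢ : ∀ {i j} → Adj i j → level i ≢ level j
  adj⇒level≢ {i} {j} adj eq = same-level (subst (Level (toℕ i)) eq (at-level i)) (at-level j)
    where
    endpoints : ∀ {r} → toℕ i % 3 ≡ r → toℕ j % 3 ≡ r →
      (toℕ i ≡ 0 × suc (toℕ j) ≡ N) ⊎ (toℕ j ≡ 0 × suc (toℕ i) ≡ N)
    endpoints i≡r j≡r = adj-residue {i} {j} adj (trans i≡r (sym j≡r))
    same-level : ∀ {l} → Level (toℕ i) l → Level (toℕ j) l → ⊥
    same-level (residue₁ i≡1) (residue₁ j≡1) =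
      [ nonzero-residue i≡1 ∘ proj₁ , nonzero-residue j≡1 ∘ proj₁ ] (endpoints i≡1 j≡1)
    same-level (residue₂ i≡2) (residue₂ j≡2) =
      [ nonzero-residue i≡2 ∘ proj₁ , nonzero-residue j≡2 ∘ proj₁ ] (endpoints i≡2 j≡2)
    same-level (residue₀ i≡0 i≢last) (residue₀ j≡0 j≢last) =
      [ j≢last ∘ proj₂ , i≢last ∘ proj₂ ] (endpoints i≡0 j≡0)
    same-level (last _ i-last) (last _ j-last)
      with refl ← toℕ-injective {i = i} {j} (suc-injective (trans i-last (sym j-last))) = adj-irrefl {i} adj

  -- The edge between `s` and `t` joins equal residues, so `s = 0` and `t = N - 1`. The only
  -- neighbour of 0 of residue 1 is 1, and the only neighbour of `N - 1` of residue 2 is `N - 2`.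
  -- From 1 to `N - 2` the residue grows by 1, which only a jump of 1 could achieve.
  no-chain : ∀ {a s t c} → Level (toℕ a) 0 → Level (toℕ s) 1 → Level (toℕ t) 2 → Level (toℕ c) 3 →
    Adj a s → Adj s t → Adj t c → ¬ Adj a c
  no-chain {a} {s} {t} {c} (residue₁ a≡1) (residue₀ s≡0 s≢last) (last t≡0 t-last) (residue₂ c≡2) as st tc ac
    = c-after-a (<-cmp (toℕ a) (toℕ c))
    where
    s-first : toℕ s ≡ 0
    s-first = [ proj₁ , (λ (_ , s-last) → contradiction s-last s≢last) ]
      (adj-residue {s} {t} st (trans s≡0 (sym t≡0)))
    from-0 : Step 0 (toℕ a) → toℕ a ≡ 1
    from-0 (shift₂ a≡2)    = contradiction (trans (sym a≡1) a≡2) λ ()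
    from-0 (next 1≡a)      = sym 1≡a
    from-0 (wrap _ a-last) =
      contradiction (trans (sym (+-residue 1 (toℕ a) refl a≡1)) (trans (cong (_% 3) a-last) N-residue)) λ ()
    a-second : toℕ a ≡ 1
    a-second = from-0 (subst (λ k → Step k (toℕ a)) s-first
      (adj⇒step (adj-sym {a} {s} as) (subst (_< toℕ a) (sym s-first) (n≢0⇒n>0 (nonzero-residue a≡1)))))
    c<t : toℕ c < toℕ t
    c<t = ≤∧≢⇒< (≤-pred (subst (toℕ c <_) (sym t-last) (toℕ<n c)))
      λ c≡t → contradiction (trans (sym c≡2) (trans (cong (_% 3) c≡t) t≡0)) λ ()
    to-t : Step (toℕ c) (toℕ t) → suc (toℕ c) ≡ toℕ t
    to-t (shift₂ t≡)  = contradiction (trans (sym t≡0) (trans t≡ (cong (λ r → (r + 2) % 3) c≡2))) λ ()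
    to-t (next eq)    = eq
    to-t (wrap c≡0 _) = contradiction c≡0 (nonzero-residue c≡2)
    c-penultimate : 2 + toℕ c ≡ N
    c-penultimate = trans (cong suc (to-t (adj⇒step (adj-sym {t} {c} tc) c<t))) t-last
    -- `1 < x < n` forces `n ≥ 3`. This excludes `N = 4`, the one case in which `c = N - 2` directly
    -- follows `a = 1`.
    N>4 : 4 < N
    N>4 = <-≤-trans (s≤s (s≤s (s≤s (s≤s (s≤s z≤n))))) (*-monoʳ-≤ 2 (≤-trans (s≤s 1<x) x<n))
    from-a : ¬ Step (toℕ a) (toℕ c)
    from-a (shift₂ c≡)  = contradiction (trans (sym c≡2) (trans c≡ (cong (λ r → (r + 2) % 3) a≡1))) λ ()
    from-a (next eq)    = <-irrefl (trans (cong (3 +_) (sym a-second)) (trans (cong (2 +_) eq) c-penultimate)) N>4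
    from-a (wrap a≡0 _) = nonzero-residue a≡1 a≡0
    c-after-a : _ → ⊥
    c-after-a (tri< a<c _ _) = from-a (adj⇒step ac a<c)
    c-after-a (tri≈ _ eq _)  = contradiction (trans (sym a≡1) (trans (cong (_% 3) eq) c≡2)) λ ()
    c-after-a (tri> _ _ c<a) = nonzero-residue c≡2 (n≤0⇒n≡0 (≤-pred (subst (toℕ c <_) a-second c<a)))

  -- The orientation by levels and its lack of shortcuts.

  E : Fin N → Fin N → Set
  E i j = Adj i j × level i < level j

  E? : ∀ i j → Dec (E i j)
  E? i j = member? _≟ℕ_ (circularDistance i j) (x ∷ 1 ∷ n ∷ []) ×-dec (level i <? level j)

  open Reachability E? level proj₂ using (_↝_; ↝⇒≤; ↝∧≥⇒≡)

  -- Three edges climb through all four levels, which leaves no room for the paths between them.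
  -- These are allowed so that the three edges may be picked anywhere along a longer path.
  no-long-path : ∀ {u a b c d e v} →
    E u a → a ↝ b → E b c → c ↝ d → E d e → e ↝ v → ¬ Adj u v
  no-long-path {u} {a} {b} {c} {d} {e} {v} (ua , u<a) ab (bc , b<c) cd (de , d<e) ev
    with four-levels (<-≤-trans u<a (↝⇒≤ ab)) (<-≤-trans b<c (↝⇒≤ cd)) (<-≤-trans d<e (↝⇒≤ ev))
                     (Level-≤3 (at-level v))
  ... | u0 , b1 , d2 , v3
    -- Each connecting path ends no higher than it starts, hence is empty.
    with refl ← ↝∧≥⇒≡ ab (≤-trans (≤-reflexive b1) (≤-trans (s≤s z≤n) u<a))
       | refl ← ↝∧≥⇒≡ cd (≤-trans (≤-reflexive d2) (subst (_< level c) b1 b<c))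
       | refl ← ↝∧≥⇒≡ ev (≤-trans (≤-reflexive v3) (subst (_< level e) d2 d<e))
    = no-chain {u} {b} {d} {v} (subst (Level _) u0 (at-level u)) (subst (Level _) b1 (at-level b))
        (subst (Level _) d2 (at-level d)) (subst (Level _) v3 (at-level v)) ua bc de

  no-shortcut : ∀ {u p q v} → u ↝ p → p ↝ q → q ↝ v → E u v → p ≢ q → E p q
  no-shortcut _ ε _ _ p≢p = contradiction refl p≢p
  no-shortcut _ (e ◅ ε) _ _ _ = e
  -- Here `p = u` and `q = v`, and the given edge is the one wanted.
  no-shortcut ε (_ ◅ _ ◅ _) ε uv _ = uv
  -- Two edges between `p` and `q` and a third before `p` make a long path.
  no-shortcut {u} {v = v} (_◅_ {j = a} f up) (e ◅ e′ ◅ pq) qv (uv , _) _ =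
    contradiction uv (no-long-path {u} {a} {v = v} f up e ε e′ (pq ◅◅ qv))
  -- Now the third edge comes after `q`.
  no-shortcut {u} {v = v} ε (_◅_ {j = a} e (e′ ◅ pq)) (g ◅ qv) (uv , _) _ =
    contradiction uv (no-long-path {u} {a} {v = v} e ε e′ pq g qv)

  orient : ∀ {i j} → Adj i j → E i j ⊎ E j i
  orient {i} {j} adj with <-cmp (level i) (level j)
  ... | tri< i<j _ _ = inj₁ (adj , i<j)
  ... | tri≈ _ eq _  = contradiction eq (adj⇒level≢ {i} {j} adj)
  ... | tri> _ _ j<i = inj₂ (adj-sym {i} {j} adj , j<i)

  wordRepresentable-C₂ₙ : WordRepresentable G
  wordRepresentable-C₂ₙ = wordRepresentable G (λ {i} {j} → orient {i} {j}) proj₁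
    where open SemiTransitive E? level proj₂ no-shortcut

theorem21 : (n x : ℕ) (1<x : 1 < x) (x<n : x < n) →
    n % 3 ≡ 2 → x % 3 ≡ 2 → WordRepresentable (C₂ₙ n x 1<x x<n)
theorem21 = wordRepresentable-C₂ₙ
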